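{- Let $e$ be the environment assigning to every type variable the relation $=_{\beta\eta}$. Then: (1) for every $\forall^+$ type $P$, $\llbracket P\rrbracket_e \subseteq\ =_{\beta\eta}$ (i.e. $t\,\llbracket P\rrbracket_e\,t'$ implies $t=_{\beta\eta}t'$); (2) for every $\forall^-$ type $N$, $=_{\beta\eta}\ \subseteq \llbracket N\rrbracket_e$ (i.e. $t=_{\beta\eta}t'$ implies $t\,\llbracket N\rrbracket_e\,t'$).
   Context: Terms are those of the pure untyped $\lambda$-calculus, $t ::= x \mid \lambda x.t \mid t\,t'$, up to $\alpha$-equivalence; $=_{\beta\eta}$ is $\beta\eta$-convertibility. Relational types are given by $R ::= X \mid R\to R' \mid \forall X.R \mid R^{\cup} \mid R\cdot R' \mid t$, where $X$ ranges over type variables and the last form is the promotion of a term $t$ to a type. A binary relation $r$ on terms is $\beta\eta$-closed if $t_1\,r\,t_2$, $t_1'=_{\beta\eta}t_1$, $t_2'=_{\beta\eta}t_2$ imply $t_1'\,r\,t_2'$; $\mathcal{R}$ is the set of such relations. An environment $\gamma$ maps type variables to elements of $\mathcal{R}$; $\gamma[X\mapsto r]$ is its update. The interpretation (written $t\,\llbracket R\rrbracket_\gamma\,t'$ for membership) is: $\llbracket X\rrbracket_\gamma=\gamma(X)$; $t\,\llbracket R\to R'\rrbracket_\gamma\,t'$ iff for all $a,a'$ with $a\,\llbracket R\rrbracket_\gamma\,a'$ we have $t\,a\,\llbracket R'\rrbracket_\gamma\,t'\,a'$; $\llbracket \forall X.R\rrbracket_\gamma=\bigcap_{r\in\mathcal{R}}\llbracket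 R\rrbracket_{\gamma[X\mapsto r]}$; $t\,\llbracket R^\cup\rrbracket_\gamma\,t'$ iff $t'\,\llbracket R\rrbracket_\gamma\,t$; $t\,\llbracket R\cdot R'\rrbracket_\gamma\,t'$ iff there is $t''$ with $t\,\llbracket R\rrbracket_\gamma\,t''$ and $t''\,\llbracket R'\rrbracket_\gamma\,t'$; $\llbracket \hat t\rrbracket_\gamma=\{(t,t')\mid \hat t\,t=_{\beta\eta}t'\}$ for a promoted term $\hat t$. Polarities are $p\in\{+,-\}$, with $\bar p$ the other polarity. The property $\forall^p$ of types is defined inductively: every type variable is $\forall^p$; if $R$ is $\forall^{\bar p}$ and $R'$ is $\forall^p$ then $R\to R'$ is $\forall^p$; if $R$ is $\forall^+$ then $\forall X.R$ is $\forall^+$; if $R$ is $\forall^p$ then $R^\cup$ is $\forall^p$; the promotion of a term $t$ with $t=_{\beta\eta}\lambda x.x$ is $\forall^p$ (no other types are $\forall^p$). -}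

module Defs where

open import Level using (Level; Lift; lift) renaming (suc to lsuc)
open import Data.Nat using (ℕ; zero; suc; _≟_)
open import Data.Bool using (if_then_else_)
open import Data.Product using (_×_; ∃-syntax)
open import Relation.Binary using (Rel)
open import Relation.Nullary using (does)

-- Untyped λ-terms up to α-equivalence, as de Bruijn terms.  Terms may be open:
-- under k binders, `var (k + i)` is the i-th of countably many free variables.

data Term : Set where
  var : ℕ → Term
  lam : Term → Term
  _·_ : Term → Term → Term

infixl 9 _·_

extᵣ : (ℕ → ℕ) → (ℕ → ℕ)
extᵣ ρ zero    = zero
extᵣ ρ (suc i) = suc (ρ i)

rename : (ℕ → ℕ) → Term → Term
rename ρ (var i) = var (ρ i)
rename ρ (lam t) = lam (rename (extᵣ ρ) t)
rename ρ (t · u) = rename ρ t · rename ρ u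

shift : Term → Term
shift = rename suc

extₛ : (ℕ → Term) → (ℕ → Term)
extₛ σ zero    = var zero
extₛ σ (suc i) = shift (σ i)

subst : (ℕ → Term) → Term → Term
subst σ (var i) = σ i
subst σ (lam t) = lam (subst (extₛ σ) t)
subst σ (t · u) = subst σ t · subst σ u

single : Term → (ℕ → Term)
single u zero    = u
single u (suc i) = var i

-- Substitutes for index 0 only, lowering the remaining free indices by one.
_[_] : Term → Term → Term
t [ u ] = subst (single u) t

infix 4 _=βη_

data _=βη_ : Term → Term → Set where
  β     : ∀ {t u} → lam t · u =βη t [ u ]
  η     : ∀ {t} → lam (shift t · var 0) =βη t
  ξ     : ∀ {t t'} → t =βη t' → lam t =βη lam t'
  app   : ∀ {t t' u u'} → t =βη t' → u =βη u' → t · u =βη t' · u'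
  refl  : ∀ {t} → t =βη t
  sym   : ∀ {t t'} → t =βη t' → t' =βη t
  trans : ∀ {t t' t''} → t =βη t' → t' =βη t'' → t =βη t''

TyVar : Set
TyVar = ℕ

infixr 6 _⇒_
infixl 7 _⨾_
infix  8 _∪

data Type : Set where
  tvar : TyVar → Type
  _⇒_  : Type → Type → Type
  all  : TyVar → Type → Type
  _∪   : Type → Type
  _⨾_  : Type → Type → Type
  ⌈_⌉  : Term → Type

βη-Closed : ∀ {ℓ} → Rel Term ℓ → Set ℓ
βη-Closed r = ∀ {t₁ t₂ t₁' t₂'} → r t₁ t₂ → t₁' =βη t₁ → t₂' =βη t₂ → r t₁' t₂'

record 𝓡 (ℓ : Level) : Set (lsuc ℓ) where
  field
    rel    : Rel Term ℓ
    closed : βη-Closed rel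

open 𝓡 public

Env : (ℓ : Level) → Set (lsuc ℓ)
Env ℓ = TyVar → 𝓡 ℓ

_[_↦_] : ∀ {ℓ} → Env ℓ → TyVar → 𝓡 ℓ → Env ℓ
(γ [ X ↦ r ]) Y = if does (X ≟ Y) then r else γ Y

-- Agda is predicative: `all` ranges over relations valued in Set ℓ, so the
-- interpretation is valued in Set (lsuc ℓ).  The Lifts only adjust levels.
⟦_⟧ : ∀ {ℓ} → Type → Env ℓ → Rel Term (lsuc ℓ)
⟦_⟧ {ℓ} (tvar X)  γ t t' = Lift (lsuc ℓ) (rel (γ X) t t')
⟦_⟧     (R ⇒ R')  γ t t' = ∀ a a' → ⟦ R ⟧ γ a a' → ⟦ R' ⟧ γ (t · a) (t' · a')
⟦_⟧ {ℓ} (all X R) γ t t' = (r : 𝓡 ℓ) → ⟦ R ⟧ (γ [ X ↦ r ]) t t'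
⟦_⟧     (R ∪)     γ t t' = ⟦ R ⟧ γ t' t
⟦_⟧     (R ⨾ R')  γ t t' = ∃[ t'' ] (⟦ R ⟧ γ t t'' × ⟦ R' ⟧ γ t'' t')
⟦_⟧ {ℓ} ⌈ t̂ ⌉     γ t t' = Lift (lsuc ℓ) (t̂ · t =βη t')

data Polarity : Set where
  + - : Polarity

opposite : Polarity → Polarity
opposite + = -
opposite - = +

data Forall : Polarity → Type → Set where
  tvar : ∀ {p} X → Forall p (tvar X)
  _⇒_  : ∀ {p R R'} → Forall (opposite p) R → Forall p R' → Forall p (R ⇒ R')
  all  : ∀ {R} X → Forall + R → Forall + (all X R)
  _∪   : ∀ {p R} → Forall p R → Forall p (R ∪)
  ⌈_⌉  : ∀ {p t} → t =βη lam (var 0) → Forall p ⌈ t ⌉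

βη : ∀ ℓ → 𝓡 ℓ
βη ℓ .rel t t' = Lift ℓ (t =βη t')
βη ℓ .closed (lift eq) eq₁ eq₂ = lift (trans eq₁ (trans eq (sym eq₂)))

e : ∀ ℓ → Env ℓ
e ℓ X = βη ℓ

{-# OPTIONS --safe #-}
-- Simultaneous induction on the polarity derivation.  For a positive arrow,
-- apply both terms to the same variable x, free in neither; the induction
-- hypotheses give t x =βη t' x, and abstracting x and contracting by η gives
-- t =βη t'.  A positive quantifier is instantiated with =βη itself; the updated
-- environment is then only pointwise equivalent to e, so the induction ranges
-- over all environments that interpret every variable as =βη up to equivalence.
module Submission where

open import Level using (Level; lift; lower)
open import Data.Bool using (true; false; if_then_else_)
open import Data.Nat using (ℕ; zero; suc; _<_; _≟_; _⊔_)
open import Data.Nat.Properties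
  using (<-trans; n<1+n; <⇒≢; <-≤-trans; m≤m⊔n; m≤n⊔m)
open import Data.Product using (_×_; _,_; ∃-syntax)
open import Function using (_⇔_; mk⇔; Equivalence)
open import Relation.Binary.PropositionalEquality as ≡
  using (_≡_; refl; cong; cong₂)
open import Relation.Nullary using (does)
open import Relation.Nullary.Decidable using (dec-true; dec-false)
open import Defs

open Equivalence using (to; from)

-- In this and the following fusion lemmas the composite is a separate `τ`, given only pointwise:
-- such a hypothesis passes under binders without function extensionality.
extᵣ-fusion : ∀ {ρ ρ' τ} → (∀ i → ρ' (ρ i) ≡ τ i) →
              ∀ i → extᵣ ρ' (extᵣ ρ i) ≡ extᵣ τ i
extᵣ-fusion eq zero    = refl
extᵣ-fusion eq (suc i) = cong suc (eq i)

rename-rename : ∀ {ρ ρ' τ} → (∀ i → ρ' (ρ i) ≡ τ i) →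
                ∀ t → rename ρ' (rename ρ t) ≡ rename τ t
rename-rename eq (var i) = cong var (eq i)
rename-rename eq (lam t) = cong lam (rename-rename (extᵣ-fusion eq) t)
rename-rename eq (t · u) = cong₂ _·_ (rename-rename eq t) (rename-rename eq u)

rename-shift : ∀ ρ t → rename (extᵣ ρ) (shift t) ≡ shift (rename ρ t)
rename-shift ρ t = ≡.trans (rename-rename (λ _ → refl) t)
                           (≡.sym (rename-rename (λ _ → refl) t))

extₛ-extᵣ : ∀ {ρ σ τ} → (∀ i → σ (ρ i) ≡ τ i) →
            ∀ i → extₛ σ (extᵣ ρ i) ≡ extₛ τ i
extₛ-extᵣ eq zero    = refl
extₛ-extᵣ eq (suc i) = cong shift (eq i)

subst-rename : ∀ {ρ σ τ} → (∀ i → σ (ρ i) ≡ τ i) →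
               ∀ t → subst σ (rename ρ t) ≡ subst τ t
subst-rename eq (var i) = eq i
subst-rename eq (lam t) = cong lam (subst-rename (extₛ-extᵣ eq) t)
subst-rename eq (t · u) = cong₂ _·_ (subst-rename eq t) (subst-rename eq u)

rename-extₛ : ∀ {ρ σ τ} → (∀ i → rename ρ (σ i) ≡ τ i) →
              ∀ i → rename (extᵣ ρ) (extₛ σ i) ≡ extₛ τ i
rename-extₛ eq zero = refl
rename-extₛ {ρ} {σ} eq (suc i) = ≡.trans (rename-shift ρ (σ i)) (cong shift (eq i))

rename-subst : ∀ {ρ σ τ} → (∀ i → rename ρ (σ i) ≡ τ i) →
               ∀ t → rename ρ (subst σ t) ≡ subst τ t
rename-subst eq (var i) = eq i
rename-subst eq (lam t) = cong lam (rename-subst (rename-extₛ eq) t)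
rename-subst eq (t · u) = cong₂ _·_ (rename-subst eq t) (rename-subst eq u)

single-extᵣ : ∀ ρ u i → single (rename ρ u) (extᵣ ρ i) ≡ rename ρ (single u i)
single-extᵣ ρ u zero    = refl
single-extᵣ ρ u (suc i) = refl

-- Both sides are `t` under the single substitution sending `i` to `rename ρ (single u i)`.
rename-[] : ∀ ρ t u → rename ρ (t [ u ]) ≡ rename (extᵣ ρ) t [ rename ρ u ]
rename-[] ρ t u = ≡.trans (rename-subst (λ _ → refl) t)
                          (≡.sym (subst-rename (single-extᵣ ρ u) t))

≡⇒βη : ∀ {t t'} → t ≡ t' → t =βη t'
≡⇒βη refl = refl

rename-βη : ∀ ρ {t t'} → t =βη t' → rename ρ t =βη rename ρ t'
rename-βη ρ (β {t} {u})   = trans β (≡⇒βη (≡.sym (rename-[] ρ t u)))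
rename-βη ρ (η {t})       =
  trans (ξ (app (≡⇒βη (rename-shift ρ t)) refl)) η
rename-βη ρ (ξ eq)        = ξ (rename-βη (extᵣ ρ) eq)
rename-βη ρ (app eq eq')  = app (rename-βη ρ eq) (rename-βη ρ eq')
rename-βη ρ refl          = refl
rename-βη ρ (sym eq)      = sym (rename-βη ρ eq)
rename-βη ρ (trans eq eq') = trans (rename-βη ρ eq) (rename-βη ρ eq')

-- A bound on the free variables of t, expressed through renaming only.
Below : ℕ → Term → Set
Below n t = ∀ {ρ ρ'} → (∀ i → i < n → ρ i ≡ ρ' i) → rename ρ t ≡ rename ρ' t

Below-⊔ˡ : ∀ {m t} n → Below m t → Below (m ⊔ n) t
Below-⊔ˡ {m} n b eq = b (λ i i<m → eq i (<-≤-trans i<m (m≤m⊔n m n)))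

Below-⊔ʳ : ∀ {n t} m → Below n t → Below (m ⊔ n) t
Below-⊔ʳ {n} m b eq = b (λ i i<n → eq i (<-≤-trans i<n (m≤n⊔m m n)))

extᵣ-agree : ∀ {n ρ ρ'} → (∀ i → i < n → ρ i ≡ ρ' i) →
             ∀ i → i < n → extᵣ ρ i ≡ extᵣ ρ' i
extᵣ-agree eq zero    _    = refl
extᵣ-agree eq (suc i) i+1<n = cong suc (eq i (<-trans (n<1+n i) i+1<n))

bounded : ∀ t → ∃[ n ] Below n t
bounded (var i) = suc i , λ eq → cong var (eq i (n<1+n i))
-- The body's bound is kept rather than lowered: agreement below `n` survives `extᵣ`, so a sharp
-- bound is unnecessary.
bounded (lam t) with n , b ← bounded t =
  n , λ eq → cong lam (b (extᵣ-agree eq))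
bounded (t · u) with m , b ← bounded t | n , c ← bounded u =
  m ⊔ n , λ eq → cong₂ _·_ (Below-⊔ˡ {t = t} n b eq) (Below-⊔ʳ {t = u} m c eq)

-- `lam (rename (bind k) t)` abstracts the free variable k of t.
bind : ℕ → ℕ → ℕ
bind k i = if does (i ≟ k) then zero else suc i

bind-≡ : ∀ k → bind k k ≡ zero
bind-≡ k = cong (if_then zero else suc k) (dec-true (k ≟ k) refl)

bind-< : ∀ {k} i → i < k → bind k i ≡ suc i
bind-< {k} i i<k = cong (if_then zero else suc i) (dec-false (i ≟ k) (<⇒≢ i<k))

-- Every free variable of `t` lies below `k`, where `bind k` agrees with `suc`. So `t` is merely
-- shifted, `var k` becomes `var 0`, and the result is an η-redex.
lam-bind : ∀ {k t} → Below k t → lam (rename (bind k) (t · var k)) =βη t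
lam-bind {k} b = trans (ξ (app (≡⇒βη (b bind-<)) (≡⇒βη (cong var (bind-≡ k))))) η

ext-fresh : ∀ {k t t'} → Below k t → Below k t' →
            t · var k =βη t' · var k → t =βη t'
ext-fresh {k} {t} {t'} b b' eq =
  trans (sym (lam-bind {t = t} b))
        (trans (ξ (rename-βη (bind k) eq)) (lam-bind {t = t'} b'))

extensionality : ∀ {t t'} → (∀ k → t · var k =βη t' · var k) → t =βη t'
extensionality {t} {t'} eq with m , b ← bounded t | n , b' ← bounded t' =
  -- Bounds are strict, so the index `m ⊔ n` itself is fresh for both terms.
  ext-fresh {t = t} {t' = t'}
    (Below-⊔ˡ {t = t} n b) (Below-⊔ʳ {t = t'} m b') (eq (m ⊔ n))

identity-app : ∀ {i t} → i =βη lam (var 0) → i · t =βη t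
identity-app eq = trans (app eq refl) β

IsConversion : ∀ {ℓ} → Env ℓ → Set ℓ
IsConversion γ = ∀ X {t t'} → rel (γ X) t t' ⇔ t =βη t'

e-isConversion : ∀ ℓ → IsConversion (e ℓ)
e-isConversion ℓ X = mk⇔ lower lift

update-isConversion : ∀ {ℓ} {γ : Env ℓ} X → IsConversion γ →
                      IsConversion (γ [ X ↦ βη ℓ ])
update-isConversion X c Y with does (X ≟ Y)
... | true  = mk⇔ lower lift
... | false = c Y

mutual
  positive : ∀ {ℓ} {γ : Env ℓ} → IsConversion γ → ∀ {P} → Forall + P →
             ∀ {t t'} → ⟦ P ⟧ γ t t' → t =βη t'
  positive c (tvar X) (lift r) = to (c X) r
  -- The domain is negative, so reflexivity of conversion relates `var k` to itself there.
  positive c (N ⇒ P) r =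
    extensionality (λ k → positive c P (r (var k) (var k) (negative c N refl)))
  positive c (all X P) r = positive (update-isConversion X c) P (r (βη _))
  positive c (P ∪) r = sym (positive c P r)
  positive c ⌈ eq ⌉ (lift r) = trans (sym (identity-app eq)) r

  -- Quantified types are only ever positive, hence no `all` case.
  negative : ∀ {ℓ} {γ : Env ℓ} → IsConversion γ → ∀ {N} → Forall - N →
             ∀ {t t'} → t =βη t' → ⟦ N ⟧ γ t t'
  negative c (tvar X) r = lift (from (c X) r)
  -- The domain is positive, so related arguments are convertible and congruence of application
  -- applies.
  negative c (P ⇒ N) r a a' s = negative c N (app r (positive c P s))
  negative c (N ∪) r = negative c N (sym r)
  negative c ⌈ eq ⌉ r = lift (trans (identity-app eq) r)

mainTheorem1 : (ℓ : Level) →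
    (∀ P → Forall + P → ∀ t t' → ⟦ P ⟧ (e ℓ) t t' → t =βη t')
    × (∀ N → Forall - N → ∀ t t' → t =βη t' → ⟦ N ⟧ (e ℓ) t t')
mainTheorem1 ℓ =
    (λ _ P _ _ → positive (e-isConversion ℓ) P)
  , (λ _ N _ _ → negative (e-isConversion ℓ) N)
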